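{- Let $\{(X_n, w_n)\}_{n \in \mathbb{N}}$ be a sequence of finite $k$-regular marked graphs that strongly converges to the $k$-regular marked graph $(X, w)$, with covering maps $p_n: X_{n+1} \to X_n$ and $\rho_n: X \to X_n$ as in the definition of strong convergence. Let $F$ be a finite $d$-regular graph, let $\phi_1$ be an $\mathrm{Aut}(F)$-voltage assignment on $X_1$, define inductively $\phi_{n+1}(uv) = \phi_n(p_n(u)p_n(v))$ on $X_{n+1}$, and $\phi(uv) = \phi_1(\rho_1(u)\rho_1(v))$ on $X$. Then for each $i \in V(F)$ the covering sequence $\{(X_n \times^{\phi_n} F, (w_n, i))\}_{n \in \mathbb{N}}$ strongly converges to $(X \times^{\phi} F, (w, i))$.
   Context: A covering map $p: \tilde G \to G$ is a graph map that restricts to a bijection from the neighbour set $N(x)$ onto $N(p(x))$ for each vertex $x$. $B_X(w,s)$ denotes the combinatorial ball of radius $s$ about $w$. A sequence $\{(X_n,w_n)\}_{n\ge1}$ of finite marked graphs strongly converges to $(X,w)$ if: (1) every $X_n$ is $r$-regular (for some fixed $r$) and there are covering maps $p_n: X_{n+1} \to X_n$; (2) $X$ is $r$-regular; (3) there are covering maps $\rho_n: X \to X_n$ with $\rho_1 = p_1 \circ \cdots \circ p_{n-1} \circ \rho_n$ for all $n$, and for each $n$ the restriction of $\rho_n$ to $B_X(w,s_n)$ is an isometry onto $B_{X_n}(w_n,s_n)$, where $s_n \to \infty$. For a graph $G$, $E(\overrightarrow{G})$ is the set of ordered edges; an $\mathrm{Aut}(F)$-voltage assignment on $G$ is a map $\phi: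 E(\overrightarrow{G}) \to \mathrm{Aut}(F)$ with $\phi(uv) = \phi(vu)^{ -1}$. The graph bundle $G \times^{\phi} F$ has vertex set $V(G)\times V(F)$, with $(u,i) \sim (v,j)$ iff either $u \sim v$ and $j = i^{\phi(uv)}$ (the image of $i$ under $\phi(uv)$), or $u = v$ and $i \sim j$ in $F$.
   Formalization: Strong convergence is taken to include that each covering map ρ_n sends the marked vertex w to w_n (assumed for X and proved for the bundles); the definition leaves this unsaid, and without it the claim fails, e.g. for a constant sequence of triangles with w_n ≠ w. -}

module Defs where

open import Axiom.UniquenessOfIdentityProofs.WithK using (uip)
open import Data.Empty using (⊥-elim)
open import Data.Fin.Base using (Fin)
open import Data.Nat.Base using (ℕ; zero; suc; _≤_)
open import Data.Product using (Σ; Σ-syntax; ∃-syntax; _×_; _,_; proj₁; proj₂)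
open import Data.Sum.Base using (_⊎_; inj₁; inj₂)
open import Function.Base using (id; _∘_)
open import Function.Bundles using (_↔_; _⇔_; Inverse)
open import Function.Definitions using (Bijective)
open import Relation.Binary.Core using (Rel)
open import Relation.Binary.Definitions using (Symmetric; Irreflexive; Irrelevant)
open import Relation.Binary.PropositionalEquality
  using (_≡_; refl; sym; trans; cong; cong₂)
open import Level using (0ℓ)

-- Simple undirected graphs.  Adjacency is proof-irrelevant, so that an element
-- of Adj u v is the ordered edge uv itself and there is at most one such edge.
record Graph : Set₁ where
  field
    V          : Set
    Adj        : Rel V 0ℓ
    adj-prop   : Irrelevant Adj
    adj-sym    : Symmetric Adj
    adj-irrefl : Irreflexive _≡_ Adj

open Graph public

MarkedGraph : Set₁
MarkedGraph = Σ Graph V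

Nbr : (G : Graph) → V G → Set
Nbr G x = Σ (V G) (Adj G x)

Finite : Graph → Set
Finite G = ∃[ n ] (Fin n ↔ V G)

Regular : ℕ → Graph → Set
Regular r G = ∀ x → Fin r ↔ Nbr G x

data Walk (G : Graph) : V G → V G → ℕ → Set where
  []  : ∀ {x} → Walk G x x zero
  _∷_ : ∀ {x y z n} → Adj G x y → Walk G y z n → Walk G x z (suc n)

-- d(x , y) = n.  A relation, since distance is partial on a disconnected graph.
IsDist : (G : Graph) → V G → V G → ℕ → Set
IsDist G x y n = Walk G x y n × (∀ m → Walk G x y m → n ≤ m)

Ball : (G : Graph) → V G → ℕ → V G → Set
Ball G w s x = ∃[ n ] (n ≤ s × Walk G w x n)

-- The restriction of f to the vertex set P is an isometry onto the vertex set Q,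
-- for the path metrics of the ambient graphs G and H.
record IsometryOnto (G H : Graph) (f : V G → V H)
                    (P : V G → Set) (Q : V H → Set) : Set where
  field
    maps-into : ∀ x → P x → Q (f x)
    onto      : ∀ y → Q y → ∃[ x ] (P x × f x ≡ y)
    isometric : ∀ x x′ → P x → P x′ → ∀ n →
                IsDist G x x′ n ⇔ IsDist H (f x) (f x′) n

record GraphMap (G H : Graph) : Set where
  field
    fun     : V G → V H
    fun-adj : ∀ {x y} → Adj G x y → Adj H (fun x) (fun y)

  onNbr : ∀ x → Nbr G x → Nbr H (fun x)
  onNbr x (y , e) = fun y , fun-adj e

open GraphMap public

record Covering (G̃ G : Graph) : Set where
  field
    graphMap  : GraphMap G̃ G
    bijective : ∀ x → Bijective _≡_ _≡_ (onNbr graphMap x)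

open Covering public

cover : ∀ {G̃ G} → Covering G̃ G → V G̃ → V G
cover p = fun (graphMap p)

-- Sequences are indexed from 0.  `descend X p n` is the composite
-- p 0 ∘ p 1 ∘ ⋯ ∘ p (n ∸ 1), the identity for n = 0.
descend : (X : ℕ → Graph) → (∀ n → Covering (X (suc n)) (X n)) →
          ∀ n → V (X n) → V (X 0)
descend X p zero    = id
descend X p (suc n) = descend X p n ∘ cover (p n)

TendsToInfinity : (ℕ → ℕ) → Set
TendsToInfinity s = ∀ M → ∃[ N ] (∀ n → N ≤ n → M ≤ s n)

record StronglyConverges (X : ℕ → MarkedGraph) (X∞ : MarkedGraph) : Set where
  field
    finite        : ∀ n → Finite (proj₁ (X n))
    degree        : ℕ
    regular       : ∀ n → Regular degree (proj₁ (X n))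
    p             : ∀ n → Covering (proj₁ (X (suc n))) (proj₁ (X n))
    regular-limit : Regular degree (proj₁ X∞)
    ρ             : ∀ n → Covering (proj₁ X∞) (proj₁ (X n))
    ρ-descend     : ∀ n x → cover (ρ 0) x ≡ descend (proj₁ ∘ X) p n (cover (ρ n) x)
    s             : ℕ → ℕ
    s→∞           : TendsToInfinity s
    -- Isometries between balls of marked graphs respect the marked vertices.
    ρ-mark        : ∀ n → cover (ρ n) (proj₂ X∞) ≡ proj₂ (X n)
    isometry      : ∀ n → IsometryOnto (proj₁ X∞) (proj₁ (X n)) (cover (ρ n))
                            (Ball (proj₁ X∞) (proj₂ X∞) (s n))
                            (Ball (proj₁ (X n)) (proj₂ (X n)) (s n))

record Aut (F : Graph) : Set where
  field
    perm     : V F ↔ V F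
    perm-adj : ∀ i j → Adj F i j ⇔ Adj F (Inverse.to perm i) (Inverse.to perm j)

-- Equality in Aut F, here of φ(uv) and φ(vu)⁻¹, is equality as functions on V F.
record Voltage (G F : Graph) : Set where
  field
    volt     : ∀ {u v} → Adj G u v → Aut F
    volt-inv : ∀ {u v} (e : Adj G u v) (i : V F) →
               Inverse.to (Aut.perm (volt e)) i
                 ≡ Inverse.from (Aut.perm (volt (adj-sym G e))) i

  -- act e i is i^φ(uv), where e is the edge uv.
  act : ∀ {u v} → Adj G u v → V F → V F
  act e = Inverse.to (Aut.perm (volt e))

pullback : ∀ {G̃ G F} → GraphMap G̃ G → Voltage G F → Voltage G̃ F
pullback {G̃} {G} f φ = record
  { volt     = λ e → volt (fun-adj f e)
  ; volt-inv = λ e i → trans (volt-inv (fun-adj f e) i)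
      (cong (λ e′ → Inverse.from (Aut.perm (volt e′)) i) (adj-prop G _ _))
  }
  where open Voltage φ

voltages : ∀ {F} (X : ℕ → Graph) → (∀ n → Covering (X (suc n)) (X n)) →
           Voltage (X 0) F → ∀ n → Voltage (X n) F
voltages X p φ₁ zero    = φ₁
voltages X p φ₁ (suc n) = pullback (graphMap (p n)) (voltages X p φ₁ n)

module _ (G F : Graph) (φ : Voltage G F) where
  open Voltage φ

  BundleAdj : Rel (V G × V F) 0ℓ
  BundleAdj (u , i) (v , j) =
    (Σ[ e ∈ Adj G u v ] j ≡ act e i) ⊎ (u ≡ v × Adj F i j)

  private
    prop : Irrelevant BundleAdj
    prop (inj₁ (e , q)) (inj₁ (e′ , q′)) with refl ← adj-prop G e e′ =
      cong (λ r → inj₁ (e , r)) (uip q q′)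
    prop (inj₁ (e , _)) (inj₂ (u≡v , _)) = ⊥-elim (adj-irrefl G u≡v e)
    prop (inj₂ (u≡v , _)) (inj₁ (e , _)) = ⊥-elim (adj-irrefl G u≡v e)
    prop (inj₂ (q , a)) (inj₂ (q′ , a′)) =
      cong₂ (λ r b → inj₂ (r , b)) (uip q q′) (adj-prop F a a′)

    symm : Symmetric BundleAdj
    symm {u , i} {v , j} (inj₁ (e , j≡)) = inj₁ (adj-sym G e , sym back)
      where
      back : act (adj-sym G e) j ≡ i
      back = Inverse.inverseˡ (Aut.perm (volt (adj-sym G e))) (trans j≡ (volt-inv e i))
    symm (inj₂ (u≡v , a)) = inj₂ (sym u≡v , adj-sym F a)

    irrefl : Irreflexive _≡_ BundleAdj
    irrefl refl (inj₁ (e , _)) = adj-irrefl G refl e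
    irrefl refl (inj₂ (_ , a)) = adj-irrefl F refl a

  bundle : Graph
  bundle = record
    { V          = V G × V F
    ; Adj        = BundleAdj
    ; adj-prop   = λ {x} {y} → prop {x} {y}
    ; adj-sym    = λ {x} {y} → symm {x} {y}
    ; adj-irrefl = λ {x} {y} → irrefl {x} {y}
    }

-- A covering p of base graphs compatible with the voltages induces the covering
-- p × id of bundles, and bundle walks project to base walks that are no longer, so
-- p × id is injective on balls wherever p is.  A covering that is injective on the
-- ball of radius 3s about w is an isometry on the ball of radius s: two points of
-- the smaller ball are at distance at most 2s, so the lift of a geodesic between
-- their images stays in the larger ball, where injectivity identifies its endpoint.
-- The radii s n / 3 therefore witness the convergence of the bundles.
module Submission where

open import Data.Empty using (⊥-elim)
open import Data.Fin.Properties using (+↔⊎; *↔×)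
open import Data.Nat.Base using (ℕ; zero; suc; _+_; _*_; _/_; _≤_; z≤n; s≤s)
open import Data.Nat.DivMod using (m/n*n≤m; m*n/n≡m; /-monoˡ-≤)
open import Data.Nat.Properties
  using (≤-reflexive; ≤-trans; ≤-total; +-mono-≤; m≤m+n; m≤n⇒m≤1+n; *-comm; +-identityʳ)
open import Data.Product using (∃-syntax; _×_; _,_; proj₁; proj₂)
open import Data.Product.Function.NonDependent.Propositional using (_×-↔_)
open import Data.Product.Properties using (,-injectiveˡ; ,-injectiveʳ)
open import Data.Sum.Base using (_⊎_; inj₁; inj₂)
open import Data.Sum.Function.Propositional using (_⊎-↔_)
open import Function.Bundles using (_↔_; Equivalence; mk↔ₛ′; mk⇔)
open import Function.Construct.Composition using (_↔-∘_)
open import Relation.Binary.PropositionalEquality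
  using (_≡_; refl; sym; trans; cong; cong₂; subst)
open import Defs

private variable
  G G̃ H F : Graph

-- Walks, and their lifts along coverings.

Nbr-≡ : (G : Graph) {x : V G} {a b : Nbr G x} → proj₁ a ≡ proj₁ b → a ≡ b
Nbr-≡ G {a = y , e} {b = _ , e′} refl = cong (y ,_) (adj-prop G e e′)

_++ʷ_ : ∀ {x y z m n} → Walk G x y m → Walk G y z n → Walk G x z (m + n)
[]      ++ʷ q = q
(e ∷ p) ++ʷ q = e ∷ (p ++ʷ q)

snocʷ : ∀ {x y z n} → Walk G x y n → Adj G y z → Walk G x z (suc n)
snocʷ []      f = f ∷ []
snocʷ (e ∷ p) f = e ∷ snocʷ p f

reverseʷ : ∀ {x y n} → Walk G x y n → Walk G y x n
reverseʷ         []      = []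
reverseʷ {G = G} (e ∷ p) = snocʷ (reverseʷ p) (adj-sym G e)

mapʷ : (f : GraphMap G H) → ∀ {x y n} → Walk G x y n → Walk H (fun f x) (fun f y) n
mapʷ f []      = []
mapʷ f (e ∷ p) = fun-adj f e ∷ mapʷ f p

module _ (p : Covering G̃ G) where

  lift-edge : ∀ {x y} → Adj G (cover p x) y → ∃[ x′ ] (Adj G̃ x x′ × cover p x′ ≡ y)
  lift-edge {x} {y} e with proj₂ (bijective p x) (y , e)
  ... | (x′ , e′) , eq = x′ , e′ , cong proj₁ (eq refl)

  locally-injective : ∀ {x y z} → Adj G̃ x y → Adj G̃ x z → cover p y ≡ cover p z → y ≡ z
  locally-injective {x} e e′ eq =
    cong proj₁ (proj₁ (bijective p x) {_ , e} {_ , e′} (Nbr-≡ G eq))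

  -- Surjectivity on neighbour sets lifts one edge at a time, each from the endpoint reached so far;
  -- the length is preserved.
  lift-walk : ∀ {x y n} → Walk G (cover p x) y n →
              ∃[ x′ ] (Walk G̃ x x′ n × cover p x′ ≡ y)
  lift-walk [] = _ , [] , refl
  lift-walk (e ∷ q) with lift-edge e
  ... | _ , e′ , refl with lift-walk q
  ...   | x″ , q′ , eq = x″ , e′ ∷ q′ , eq

-- Injectivity on balls versus isometry.

InjectiveOn : {A B : Set} → (A → Set) → (A → B) → Set
InjectiveOn P f = ∀ x y → P x → P y → f x ≡ f y → x ≡ y

-- Points with equal images have images at distance 0, hence are themselves at distance 0, and a
-- walk of length 0 is `[]`.
isometry-injective : ∀ {f : V G → V H} {P Q} → IsometryOnto G H f P Q → InjectiveOn P f
isometry-injective {G} {H} {f} iso x y px py eq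
  with proj₁ (Equivalence.from (IsometryOnto.isometric iso x y px py 0)
                (subst (λ z → Walk H (f x) z 0) eq [] , λ _ _ → z≤n))
... | [] = refl

injective-isometry : (p : Covering G̃ G) {w : V G̃} {v : V G} (s r : ℕ) → s * 3 ≤ r →
  cover p w ≡ v → InjectiveOn (Ball G̃ w r) (cover p) →
  IsometryOnto G̃ G (cover p) (Ball G̃ w s) (Ball G v s)
injective-isometry {G̃} {G} p {w} s r 3s≤r refl inj = record
  { maps-into = λ { x (n , n≤s , q) → n , n≤s , mapʷ (graphMap p) q }
  ; onto      = λ { y (n , n≤s , q) → let x , q′ , eq = lift-walk p q in x , (n , n≤s , q′) , eq }
  ; isometric = λ x x′ bx bx′ n → mk⇔
      (λ { (q , min) → mapʷ (graphMap p) q , shorter bx bx′ min })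
      -- The image of the walk through the centre bounds the length of the geodesic `q` by 2s, so
      -- `q` is short enough to lift with the correct endpoint.
      (λ { (q , min) → let l , short , t = through-centre bx bx′ in
             lift-short bx bx′ (≤-trans (min l (mapʷ (graphMap p) t)) short) q
           , λ m t′ → min m (mapʷ (graphMap p) t′) })
  }
  where
  s+2s≤r : s + (s + s) ≤ r
  -- `3 * s` unfolds to `s + (s + (s + 0))`.
  s+2s≤r = ≤-trans (≤-reflexive (trans (cong (λ t → s + (s + t)) (sym (+-identityʳ s))) (*-comm 3 s))) 3s≤r

  through-centre : ∀ {x x′} → Ball G̃ w s x → Ball G̃ w s x′ →
                   ∃[ l ] (l ≤ s + s × Walk G̃ x x′ l)
  through-centre (a , a≤s , q) (b , b≤s , q′) = a + b , +-mono-≤ a≤s b≤s , reverseʷ q ++ʷ q′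

  lift-short : ∀ {x x′ m} → Ball G̃ w s x → Ball G̃ w s x′ → m ≤ s + s →
               Walk G (cover p x) (cover p x′) m → Walk G̃ x x′ m
  lift-short {x} {x′} {m} (a , a≤s , q) (b , b≤s , q′) m≤2s t with lift-walk p t
  ... | x″ , t′ , eq = subst (λ z → Walk G̃ x z m) x″≡x′ t′
    where
    x″≡x′ : x″ ≡ x′
    x″≡x′ = inj x″ x′
      (a + m , ≤-trans (+-mono-≤ a≤s m≤2s) s+2s≤r , q ++ʷ t′)
      (b , ≤-trans b≤s (≤-trans (m≤m+n s (s + s)) s+2s≤r) , q′)
      eq

  -- A walk of length at most 2s lifts and is compared upstairs; a longer one already exceeds the
  -- walk through the centre.
  shorter : ∀ {x x′ n} → Ball G̃ w s x → Ball G̃ w s x′ → (∀ m → Walk G̃ x x′ m → n ≤ m) →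
            ∀ m → Walk G (cover p x) (cover p x′) m → n ≤ m
  shorter bx bx′ min m t with ≤-total m (s + s)
  ... | inj₁ m≤2s = min m (lift-short bx bx′ m≤2s t)
  ... | inj₂ 2s≤m = let l , l≤2s , q = through-centre bx bx′ in
                    ≤-trans (min l q) (≤-trans l≤2s 2s≤m)

-- Finiteness, degree and base projection of a bundle.

bundle-finite : (φ : Voltage G F) → Finite G → Finite F → Finite (bundle G F φ)
bundle-finite φ (m , f) (n , g) = m * n , (f ×-↔ g) ↔-∘ *↔×

module _ (φ : Voltage G F) where
  open Voltage φ

  -- A step along a base edge has its fibre coordinate forced by the voltage, so such steps are
  -- counted by `Nbr G u`; the remaining steps stay in the fibre. Degrees therefore add.
  bundle-nbr : ∀ u i → (Nbr G u ⊎ Nbr F i) ↔ Nbr (bundle G F φ) (u , i)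
  bundle-nbr u i = mk↔ₛ′ to from to∘from from∘to
    where
    to : Nbr G u ⊎ Nbr F i → Nbr (bundle G F φ) (u , i)
    to (inj₁ (v , e)) = (v , act e i) , inj₁ (e , refl)
    to (inj₂ (j , a)) = (u , j) , inj₂ (refl , a)

    from : Nbr (bundle G F φ) (u , i) → Nbr G u ⊎ Nbr F i
    from ((v , _) , inj₁ (e , _)) = inj₁ (v , e)
    from ((_ , j) , inj₂ (_ , a)) = inj₂ (j , a)

    to∘from : ∀ b → to (from b) ≡ b
    to∘from (_ , inj₁ (_ , refl)) = refl
    to∘from (_ , inj₂ (refl , _)) = refl

    from∘to : ∀ a → from (to a) ≡ a
    from∘to (inj₁ _) = refl
    from∘to (inj₂ _) = refl

  bundle-regular : ∀ {k d} → Regular k G → Regular d F → Regular (k + d) (bundle G F φ)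
  bundle-regular rG rF (u , i) = bundle-nbr u i ↔-∘ ((rG u ⊎-↔ rF i) ↔-∘ +↔⊎)

  project-walk : ∀ {u v n} → Walk (bundle G F φ) u v n →
                 ∃[ m ] (m ≤ n × Walk G (proj₁ u) (proj₁ v) m)
  project-walk [] = 0 , z≤n , []
  project-walk (inj₁ (e , _) ∷ q) =
    let m , m≤n , q′ = project-walk q in suc m , s≤s m≤n , e ∷ q′
  project-walk (inj₂ (refl , _) ∷ q) =
    let m , m≤n , q′ = project-walk q in m , m≤n⇒m≤1+n m≤n , q′

  project-ball : ∀ {u v} s → Ball (bundle G F φ) u s v → Ball G (proj₁ u) s (proj₁ v)
  project-ball s (n , n≤s , q) =
    let m , m≤n , q′ = project-walk q in m , ≤-trans m≤n n≤s , q′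

  -- Compares voltages of edges reached by different routes, whose endpoints agree only up to a
  -- proof.
  act-cong : ∀ {u v u′ v′} (e : Adj G u v) (e′ : Adj G u′ v′) → u ≡ u′ → v ≡ v′ →
             ∀ i → act e i ≡ act e′ i
  act-cong e e′ refl refl i = cong (λ e → act e i) (adj-prop G e e′)

-- Coverings of bundles induced by coverings of bases.

module _ (p : Covering G̃ G) (ψ : Voltage G̃ F) (φ : Voltage G F)
         (compatible : ∀ {u v} (e : Adj G̃ u v) i →
            Voltage.act ψ e i ≡ Voltage.act φ (fun-adj (graphMap p) e) i) where

  bundle-map : GraphMap (bundle G̃ F ψ) (bundle G F φ)
  bundle-map = record
    { fun     = λ { (u , i) → cover p u , i }
    ; fun-adj = λ
        { (inj₁ (e , eq)) → inj₁ (fun-adj (graphMap p) e , trans eq (compatible e _))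
        ; (inj₂ (eq , a)) → inj₂ (cong (cover p) eq , a) }
    }

  bundle-covering : Covering (bundle G̃ F ψ) (bundle G F φ)
  bundle-covering = record
    { graphMap  = bundle-map
    ; bijective = λ x →
        (λ {a} {b} eq → injective x a b (cong proj₁ eq))
      , λ b → let a , eq = surjective x b in
              a , λ { refl → Nbr-≡ (bundle G F φ) eq }
    }
    where
    same-base : ∀ {x y z} → Adj (bundle G̃ F ψ) x y → Adj (bundle G̃ F ψ) x z →
                cover p (proj₁ y) ≡ cover p (proj₁ z) → proj₁ y ≡ proj₁ z
    same-base (inj₁ (e , _)) (inj₁ (e′ , _)) eq = locally-injective p e e′ eq
    -- A base edge and a fibre edge cannot share an image: `p` would send the base edge to a loop.
    same-base (inj₁ (e , _)) (inj₂ (refl , _)) eq =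
      ⊥-elim (adj-irrefl G (sym eq) (fun-adj (graphMap p) e))
    same-base (inj₂ (refl , _)) (inj₁ (e′ , _)) eq =
      ⊥-elim (adj-irrefl G eq (fun-adj (graphMap p) e′))
    same-base (inj₂ (refl , _)) (inj₂ (refl , _)) _ = refl

    injective : ∀ x (a b : Nbr (bundle G̃ F ψ) x) →
                fun bundle-map (proj₁ a) ≡ fun bundle-map (proj₁ b) → a ≡ b
    injective x (y , e) (z , e′) eq = Nbr-≡ (bundle G̃ F ψ)
      (cong₂ _,_ (same-base {x} {y} {z} e e′ (,-injectiveˡ eq)) (,-injectiveʳ eq))

    surjective : ∀ x (b : Nbr (bundle G F φ) (fun bundle-map x)) →
                 ∃[ a ] fun bundle-map (proj₁ {B = Adj (bundle G̃ F ψ) x} a) ≡ proj₁ b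
    surjective (u , i) (_ , inj₁ (e , refl)) with lift-edge p e
    ... | u′ , e′ , refl = ((u′ , Voltage.act ψ e′ i) , inj₁ (e′ , refl))
                         -- `lift-edge` controls only the endpoint, so the image of `e′` is
                         -- identified with `e` through `act-cong`.
                         , cong (cover p u′ ,_) (trans (compatible e′ i) (act-cong φ _ e refl refl i))
    surjective (u , i) ((_ , j) , inj₂ (refl , a)) = ((u , j) , inj₂ (refl , a)) , refl

-- The tower of bundles and its limit.

module _ (X : ℕ → Graph) (p : ∀ n → Covering (X (suc n)) (X n)) (φ₁ : Voltage (X 0) F) where

  descend-adj : ∀ n {u v} → Adj (X n) u v → Adj (X 0) (descend X p n u) (descend X p n v)
  descend-adj zero    e = e
  descend-adj (suc n) e = descend-adj n (fun-adj (graphMap (p n)) e)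

  -- Unrolls the inductive definition: every level reads its voltages off `φ₁`, as the limit does,
  -- which makes the two comparable.
  act-voltages : ∀ n {u v} (e : Adj (X n) u v) i →
    Voltage.act (voltages X p φ₁ n) e i ≡ Voltage.act φ₁ (descend-adj n e) i
  act-voltages zero    e i = refl
  act-voltages (suc n) e i = act-voltages n (fun-adj (graphMap (p n)) e) i

  bundles : ℕ → Graph
  bundles n = bundle (X n) F (voltages X p φ₁ n)

  bundle-coverings : ∀ n → Covering (bundles (suc n)) (bundles n)
  -- The voltage at level `suc n` is by definition the pullback along `p n`, hence the trivial
  -- compatibility proof.
  bundle-coverings n = bundle-covering (p n) _ (voltages X p φ₁ n) (λ _ _ → refl)

  descend-bundles : ∀ n u i → descend bundles bundle-coverings n (u , i) ≡ (descend X p n u , i)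
  descend-bundles zero    u i = refl
  descend-bundles (suc n) u i = descend-bundles n (cover (p n) u) i

/-tendsToInfinity : ∀ {s} → TendsToInfinity s → TendsToInfinity (λ n → s n / 3)
/-tendsToInfinity s→∞ M =
  -- Asking for `M * 3` leaves exactly `M` after division by 3.
  let N , bound = s→∞ (M * 3) in
  N , λ n N≤n → subst (_≤ _) (m*n/n≡m M 3) (/-monoˡ-≤ 3 (bound n N≤n))

theorem2p15 : (k d : ℕ)
    (X : ℕ → Graph) (w : ∀ n → V (X n)) (X∞ : Graph) (w∞ : V X∞) →
    (∀ n → Finite (X n)) → (∀ n → Regular k (X n)) → Regular k X∞ →
    (conv : StronglyConverges (λ n → X n , w n) (X∞ , w∞)) →
    (F : Graph) → Finite F → Regular d F →
    (φ₁ : Voltage (X 0) F) →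
    (i : V F) →
    StronglyConverges
    (λ n → bundle (X n) F (voltages X (StronglyConverges.p conv) φ₁ n) , (w n , i))
    (bundle X∞ F (pullback (graphMap (StronglyConverges.ρ conv 0)) φ₁) , (w∞ , i))
theorem2p15 k d X w X∞ w∞ finX regX regX∞ conv F finF regF φ₁ i = record
  { finite        = λ n → bundle-finite (φ n) (finX n) finF
  ; degree        = k + d
  ; regular       = λ n → bundle-regular (φ n) (regX n) regF
  ; p             = bundle-coverings X p φ₁
  ; regular-limit = bundle-regular φ∞ regX∞ regF
  ; ρ             = ρ-bundle
  ; ρ-descend     = λ { n (x , j) → trans (cong (_, j) (ρ-descend n x))
                                          (sym (descend-bundles X p φ₁ n (cover (ρ n) x) j)) }
  ; s             = λ n → s n / 3
  ; s→∞           = /-tendsToInfinity s→∞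
  ; ρ-mark        = λ n → cong (_, i) (ρ-mark n)
  ; isometry      = λ n → injective-isometry (ρ-bundle n) (s n / 3) (s n) (m/n*n≤m (s n) 3)
                            (cong (_, i) (ρ-mark n)) (ρ-bundle-injective n)
  }
  where
  open StronglyConverges conv

  φ : ∀ n → Voltage (X n) F
  φ = voltages X p φ₁

  φ∞ : Voltage X∞ F
  φ∞ = pullback (graphMap (ρ 0)) φ₁

  -- Both sides are voltages under `φ₁`, one of the edge sent down by `ρ 0`, the other of the edge
  -- sent by `ρ n` and then down the tower; `ρ-descend` matches their endpoints.
  ρ-compatible : ∀ n {u v} (e : Adj X∞ u v) j →
    Voltage.act φ∞ e j ≡ Voltage.act (φ n) (fun-adj (graphMap (ρ n)) e) j
  ρ-compatible n e j = trans
    (act-cong φ₁ _ _ (ρ-descend n _) (ρ-descend n _) j)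
    (sym (act-voltages X p φ₁ n (fun-adj (graphMap (ρ n)) e) j))

  ρ-bundle : ∀ n → Covering (bundle X∞ F φ∞) (bundle (X n) F (φ n))
  ρ-bundle n = bundle-covering (ρ n) φ∞ (φ n) (ρ-compatible n)

  ρ-bundle-injective : ∀ n → InjectiveOn
    (Ball (bundle X∞ F φ∞) (w∞ , i) (s n)) (cover (ρ-bundle n))
  ρ-bundle-injective n x y bx by eq = cong₂ _,_
    (isometry-injective (isometry n) _ _
      (project-ball φ∞ (s n) bx) (project-ball φ∞ (s n) by) (,-injectiveˡ eq))
    (,-injectiveʳ eq)
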